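{- Let $V'$ be a $P_2$-algorithm, let the $i$-th step of $V'$ be a main step in which exactly two subsets are checked (for a fixed distribution $d'$ of checked subsets into steps), in places labelled $1$ and $2$, and let $S',R,T'$ be three input-sets from the input-class $V'_{input}(n,d')$ such that: $S'$ results in a subset-solution being determined as checked subset in place $1$ but none in place $2$ of the $i$-th step (outcome $1$); $R$ results in a subset-solution being determined as checked subset in place $2$ but none in place $1$ of the $i$-th step (outcome $2$); $T'$ results in no subset-solution being determined as checked subset in the $i$-th step (outcome $0$). Consider a family $F$ of boxes that assigns to each $q\in\mathbb{Q}\cap[0,1)$ a box $B'_{a,0/b}$ with $a,b\in\mathbb{N}$, $b\ne0$, $\frac{a}{b}=q$, and to $q=1$ a box $B'_{0,b/b}$ with $b\in\mathbb{N}$, $b\neq 0$. For $q\in\mathbb{Q}\cap[0,1]$ let $X'_q\in\{0,1,2\}$ be the outcome of an input-set selected uniformly at random from the box that $F$ assigns to $q$, and let $\pi_1(q)=\mathrm{prob}\{X'_q=1\}$. Then $$\pi_1(q)=\begin{cases} q & \text{if } q\in\mathbb{Q}\cap[0,1),\\ 0 & \text{if } q=1,\end{cases}$$ and the function $\pi_1:\mathbb{Q}\cap[0,1]\to[0,1]$ is discontinuous at the point $1$.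
   Context: Subset-sum problem: given a set of $n$ integers (an input-set), decide whether some non-empty subset sums to zero; such a subset is called a subset-solution. Only algorithms that determine, for every non-empty subset of the input-set, whether it is a subset-solution are considered. An algorithm checks a subset in a step if in that step it performs the final necessary operation to determine that subset independently of the other subsets; a step in which checking takes place is a main step. A $P_2$-algorithm is one for which there is at least one main step in which more than one subset is checked. The number of steps is taken to be the worst-case number for input-sets of size $n$ (empty steps are added if fewer are needed). A distribution is the tuple $d'=(d'_1,\dots,d'_k)$, where $k$ is the number of steps and $d'_j$ is the number of subsets checked in step $j$. An input-class $V'_{input}(n,d')$ is a class containing infinitely many input-sets of size $n$ that result in the same distribution $d'$ for $V'$. For the random experiment, each of $S',R,T'$ has a fixed outcome: $1$ for $S'$, $2$ for $R$, $0$ for $T'$. For $a_1,a_2,b\in\mathbb{N}$ with $b\neq0$ and $a=a_1+a_2\le b$, the box $B'_{a_1,a_2/b}$ is the multiset of cardinality $b$ with $a_1$ instances of $S'$, $a_2$ instances of $R$ and $b-a$ instances of $T'$; all $b$ instances are equally likely to be selected. In general, a box used for the value $q$ must satisfy $\frac{a_1+a_2}{b}=q$. $\mathbb{N}$ includes $0$. $\mathbb{Q}\cap[0,1]$ and $[0,1]$ carry the topology induced from $\mathbb{R}$. -}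

module Defs where

open import Data.Bool.Base using (Bool; true; false; T)
import Data.Bool.Properties as Bool
open import Data.Fin.Base using (Fin; toℕ)
open import Data.Fin.Patterns using (0F; 1F; 2F)
import Data.Fin.Properties as Fin
open import Data.Fin.Subset using (Subset; Nonempty; inside; outside)
open import Data.Fin.Subset.Properties using (nonempty?)
open import Data.Integer.Base as ℤ using (ℤ; +_; 0ℤ)
import Data.Integer.Properties as ℤ
open import Data.List.Base as List using (List)
open import Data.List.Membership.Propositional using (_∈_)
open import Data.Maybe using (Maybe; just; nothing; Is-just)
import Data.Maybe.Properties as Maybe
import Data.Maybe.Relation.Unary.Any as MaybeAny
open import Data.Nat.Base as ℕ using (ℕ; zero; suc; _+_; _∸_; NonZero)
open import Data.Nat.GeneralisedArithmetic using (fold)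
import Data.Nat.Properties as ℕ
open import Data.Product.Base using (∃-syntax; _×_)
open import Data.Rational.Base as ℚ using (ℚ; 0ℚ; 1ℚ; _/_)
import Data.Rational.Properties as ℚ
import Data.Rational.Unnormalised.Base as ℚᵘ
import Data.Rational.Unnormalised.Properties as ℚᵘ
open import Data.Unit.Base using (tt)
open import Data.Vec.Base using (Vec; []; _∷_; _++_; cast; count; lookup; replicate; tabulate)
open import Data.Vec.Properties using (count≤n)
open import Data.Vec.Relation.Unary.AllPairs using (AllPairs)
open import Function.Bundles using (_⇔_)
open import Level using (0ℓ)
open import Relation.Binary.PropositionalEquality using (_≡_; subst₂; sym)
open import Relation.Nullary using (¬_; Dec; yes; does)
open import Relation.Nullary.Decidable using (_×-dec_)
open import Relation.Unary using (Pred; Decidable; _⊆_)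

private variable
  n : ℕ

-- A set of n integers is represented by its increasing enumeration; its
-- subsets are then the subsets of the n positions.
record InputSet (n : ℕ) : Set where
  field
    elements    : Vec ℤ n
    .increasing : AllPairs ℤ._<_ elements

open InputSet public

subsetSum : Vec ℤ n → Subset n → ℤ
subsetSum []       []            = 0ℤ
subsetSum (x ∷ xs) (inside  ∷ A) = x ℤ.+ subsetSum xs A
subsetSum (_ ∷ xs) (outside ∷ A) = subsetSum xs A

IsSubsetSolution : InputSet n → Subset n → Set
IsSubsetSolution I A = Nonempty A × subsetSum (elements I) A ≡ 0ℤ

-- `verdict s A` is what has been established about A itself, independently of
-- the other subsets, by the time the computation is in state s: `nothing` if A
-- is still undetermined, `just b` if it is determined, b telling whether A is
-- a subset-solution.
record Algorithm : Set₁ where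
  field
    State   : ℕ → Set
    init    : InputSet n → State n
    step    : State n → State n
    halted  : State n → Bool
    verdict : State n → Subset n → Maybe Bool

  -- The state after the given number of steps.
  run : InputSet n → ℕ → State n
  run I k = fold (init I) step k

  field
    -- Steps taken after halting are the empty steps that pad a computation to
    -- the worst-case length.
    step-halted : (s : State n) → T (halted s) → step s ≡ s

    -- The worst-case number of steps for input-sets of size n.
    numSteps        : ℕ → ℕ
    numSteps-enough : (I : InputSet n) → T (halted (run I (numSteps n)))
    numSteps-least  : ∀ k → (∀ (I : InputSet n) → T (halted (run I k))) →
                      numSteps n ℕ.≤ k

    verdict-init     : (I : InputSet n) {A : Subset n} → Nonempty A →
                       verdict (init I) A ≡ nothing
    verdict-persists : (I : InputSet n) {A : Subset n} → Nonempty A →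
                       ∀ k {b} → verdict (run I k) A ≡ just b →
                       verdict (run I (suc k)) A ≡ just b
    verdict-correct  : (I : InputSet n) {A : Subset n} → Nonempty A →
                       ∀ k {b} → verdict (run I k) A ≡ just b →
                       (b ≡ true) ⇔ IsSubsetSolution I A
    verdict-complete : (I : InputSet n) {A : Subset n} → Nonempty A →
                       ∀ k → T (halted (run I k)) → Is-just (verdict (run I k) A)

open Algorithm public using (run; numSteps; verdict)

Step : Algorithm → ℕ → Set
Step V n = Fin (numSteps V n)

-- Step j leads from `run V I j` to `run V I (suc j)`; it checks A if it is the
-- step in which A becomes determined.
Checks : (V : Algorithm) → InputSet n → Step V n → Subset n → Set
Checks V I j A = Nonempty A
               × verdict V (run V I (toℕ j)) A ≡ nothing
               × Is-just (verdict V (run V I (suc (toℕ j))) A)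

checks? : (V : Algorithm) (I : InputSet n) (j : Step V n) → Decidable (Checks V I j)
checks? V I j A = nonempty? A
            ×-dec Maybe.≡-dec Bool._≟_ (verdict V (run V I (toℕ j)) A) nothing
            ×-dec MaybeAny.dec (λ _ → yes tt) (verdict V (run V I (suc (toℕ j))) A)

allSubsets : ∀ n → List (Subset n)
allSubsets zero    = [] List.∷ List.[]
allSubsets (suc n) = List.map (outside ∷_) (allSubsets n)
              List.++ List.map (inside  ∷_) (allSubsets n)

Distribution : Algorithm → ℕ → Set
Distribution V n = Vec ℕ (numSteps V n)

distribution : (V : Algorithm) → InputSet n → Distribution V n
distribution {n} V I =
  tabulate λ j → List.length (List.filter (checks? V I j) (allSubsets n))

IsMainStep : (V : Algorithm) → Distribution V n → Step V n → Set
IsMainStep V d j = 0 ℕ.< lookup d j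

IsP₂ : Algorithm → Set
IsP₂ V = ∃[ n ] ∃[ I ] ∃[ j ]
  IsMainStep {n} V (distribution V I) j × 1 ℕ.< lookup (distribution V I) j

Infinite : ∀ {a} {A : Set a} {ℓ} → Pred A ℓ → Set _
Infinite C = ¬ (∃[ xs ] C ⊆ (_∈ xs))

record IsInputClass (V : Algorithm) (d : Distribution V n)
                    (C : Pred (InputSet n) 0ℓ) : Set where
  field
    infinite          : Infinite C
    same-distribution : ∀ {I} → C I → distribution V I ≡ d

data Place : Set where
  place-1 place-2 : Place

-- A labelling, by the two places, of the subsets checked in step i, for each
-- input-set of the class C (values outside C are irrelevant).
record Places (V : Algorithm) (C : Pred (InputSet n) 0ℓ) (i : Step V n) : Set where
  field
    at         : InputSet n → Place → Subset n
    checked    : ∀ {I} → C I → ∀ p → Checks V I i (at I p)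
    injective  : ∀ {I} → C I → ∀ {p p′} → at I p ≡ at I p′ → p ≡ p′
    surjective : ∀ {I} → C I → ∀ {A} → Checks V I i A → ∃[ p ] at I p ≡ A

-- The outcome, given whether there is a solution in place 1 and in place 2; no
-- outcome is assigned to solutions in both places.
outcomeOf : Bool → Bool → Maybe (Fin 3)
outcomeOf true  false = just 1F
outcomeOf false true  = just 2F
outcomeOf false false = just 0F
outcomeOf true  true  = nothing

module _ (V : Algorithm) {C : Pred (InputSet n) 0ℓ} {i : Step V n}
         (L : Places V C i) where

  -- Step i determines that the subset it checks in place p is a subset-solution.
  SolutionAt : InputSet n → Place → Set
  SolutionAt I p = verdict V (run V I (suc (toℕ i))) (Places.at L I p) ≡ just true

  solutionAt? : (I : InputSet n) (p : Place) → Dec (SolutionAt I p)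
  solutionAt? I p = Maybe.≡-dec Bool._≟_ _ _

  outcome : InputSet n → Maybe (Fin 3)
  outcome I = outcomeOf (does (solutionAt? I place-1)) (does (solutionAt? I place-2))

record [0,1]ℚ : Set where
  constructor mk
  field
    value   : ℚ
    0≤value : 0ℚ ℚ.≤ value
    value≤1 : value ℚ.≤ 1ℚ

open [0,1]ℚ public

one : [0,1]ℚ
one = mk 1ℚ (ℚ.nonNegative⁻¹ 1ℚ) ℚ.≤-refl

private
  frac≤1 : ∀ {c b} .{{_ : NonZero b}} → c ℕ.≤ b → (+ c / b) ℚ.≤ 1ℚ
  frac≤1 {c} {b@(suc _)} c≤b = ℚ.toℚᵘ-cancel-≤
    (ℚᵘ.≤-respˡ-≃ (ℚᵘ.≃-sym (ℚ.toℚᵘ-fromℚᵘ (+ c ℚᵘ./ b)))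
      (ℚᵘ.*≤* (subst₂ ℤ._≤_ (sym (ℤ.*-identityʳ (+ c))) (sym (ℤ.*-identityˡ (+ b)))
        (ℤ.+≤+ c≤b))))

-- The probability that an entry of xs, selected uniformly at random, has P.
uniformProb : ∀ {a p} {A : Set a} {P : Pred A p} {b} .{{_ : NonZero b}} →
              Decidable P → Vec A b → [0,1]ℚ
uniformProb {b = b} P? xs = mk (+ count P? xs / b)
  (ℚ.nonNegative⁻¹ _ {{ℚ.normalize-nonNeg (count P? xs) b}})
  (frac≤1 (count≤n P? xs))

record Box : Set where
  field
    a₁ a₂ b       : ℕ
    {{b-nonZero}} : NonZero b
    a₁+a₂≤b       : a₁ + a₂ ℕ.≤ b

  -- The multiset of b instances, listed in some order.
  contents : (S′ R T′ : InputSet n) → Vec (InputSet n) b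
  contents S′ R T′ = cast (ℕ.m+[n∸m]≡n a₁+a₂≤b)
    ((replicate a₁ S′ ++ replicate a₂ R) ++ replicate (b ∸ (a₁ + a₂)) T′)

record BoxFamily : Set where
  field
    box : [0,1]ℚ → Box

    below-one : ∀ q → value q ℚ.< 1ℚ →
                let open Box (box q) in a₂ ≡ 0 × (+ a₁ / b) {{b-nonZero}} ≡ value q
    at-one    : ∀ q → value q ≡ 1ℚ →
                let open Box (box q) in a₁ ≡ 0 × a₂ ≡ b

-- prob {X′_q = x}, where X′_q is the outcome of an input-set selected from the
-- box that F assigns to q.
π : (V : Algorithm) {C : Pred (InputSet n) 0ℓ} {i : Step V n} (L : Places V C i)
    (S′ R T′ : InputSet n) (F : BoxFamily) → Fin 3 → [0,1]ℚ → [0,1]ℚ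
π V L S′ R T′ F x q =
  uniformProb {{b-nonZero}} (λ I → Maybe.≡-dec Fin._≟_ (outcome V L I) (just x))
              (contents S′ R T′)
  where open Box (BoxFamily.box F q)

-- Both intervals carry the metric ∣ x - y ∣.  Rational ε and δ suffice, as the
-- rationals are dense in the reals.
ContinuousAt : ([0,1]ℚ → [0,1]ℚ) → [0,1]ℚ → Set
ContinuousAt f x =
  ∀ ε → 0ℚ ℚ.< ε → ∃[ δ ] 0ℚ ℚ.< δ ×
    (∀ y → ℚ.∣ value y ℚ.- value x ∣ ℚ.< δ →
           ℚ.∣ value (f y) ℚ.- value (f x) ∣ ℚ.< ε)

DiscontinuousAt : ([0,1]ℚ → [0,1]ℚ) → [0,1]ℚ → Set
DiscontinuousAt f x = ¬ ContinuousAt f x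

{-# OPTIONS --safe #-}

-- Since only S′ has outcome 1, π₁ q is the proportion a₁ / b of copies of S′ in
-- the box: this is q for q < 1, but 0 for q = 1, where the box holds only R.
-- So π₁ exceeds 1/2 at points 1 - t arbitrarily close to 1, yet vanishes at 1.
module Submission where

open import Defs
import Algebra.Properties.AbelianGroup as AbelianGroupProperties
open import Data.Bool.Base using (true; false)
open import Data.Fin.Patterns using (0F; 1F; 2F)
open import Data.Integer.Base using (+_)
open import Data.Maybe.Base using (just)
open import Data.Nat.Base as ℕ using (ℕ; zero; suc)
import Data.Nat.Properties as ℕ
open import Data.Product.Base using (_×_; _,_; proj₁; proj₂)
open import Data.Rational.Base using (ℚ; 0ℚ; 1ℚ; ½; _<_; _≤_; _-_; -_; _⊓_; ∣_∣; _/_)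
open import Data.Rational.Properties
open import Data.Sum.Base using (inj₁; inj₂)
open import Data.Vec.Base using (Vec; []; _∷_; _++_; cast; count; lookup; replicate)
open import Function.Base using (case_of_)
open import Level using (0ℓ)
open import Relation.Binary.PropositionalEquality using (_≡_; refl; sym; trans; cong; cong₂; subst; module ≡-Reasoning)
open import Relation.Nullary using (¬_; does)
open import Relation.Nullary.Decidable using (dec-true; dec-false; from-yes)
open import Relation.Unary using (Pred; Decidable)

open AbelianGroupProperties +-0-abelianGroup using (xyx⁻¹≈y)

module _ {a p} {A : Set a} {P : Pred A p} (P? : Decidable P) where

  count-++ : ∀ {m n} (xs : Vec A m) (ys : Vec A n) →
             count P? (xs ++ ys) ≡ count P? xs ℕ.+ count P? ys
  count-++ []       ys = refl
  count-++ (x ∷ xs) ys with does (P? x)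
  ... | true  = cong suc (count-++ xs ys)
  ... | false = count-++ xs ys

  count-cast : ∀ {m n} .(eq : m ≡ n) (xs : Vec A m) →
               count P? (cast eq xs) ≡ count P? xs
  count-cast {n = zero}  eq []       = refl
  count-cast {n = suc _} eq (x ∷ xs) with does (P? x)
  ... | true  = cong suc (count-cast (cong ℕ.pred eq) xs)
  ... | false = count-cast (cong ℕ.pred eq) xs

  count-replicate-yes : ∀ {x} → P x → ∀ n → count P? (replicate n x) ≡ n
  count-replicate-yes px zero = refl
  count-replicate-yes {x} px (suc n) rewrite dec-true (P? x) px =
    cong suc (count-replicate-yes px n)

  count-replicate-no : ∀ {x} → ¬ P x → ∀ n → count P? (replicate n x) ≡ 0
  count-replicate-no ¬px zero = refl
  count-replicate-no {x} ¬px (suc n) rewrite dec-false (P? x) ¬px =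
    count-replicate-no ¬px n

module _ {n p} {P : Pred (InputSet n) p} (P? : Decidable P) {S′ R T′ : InputSet n}
         (PS′ : P S′) (¬PR : ¬ P R) (¬PT′ : ¬ P T′) (B : Box) where

  open Box B

  -- The box is listed as three constant blocks, and a constant block counts either in full or not
  -- at all. Here only the block of `S′` survives.
  count-contents : count P? (contents S′ R T′) ≡ a₁
  count-contents = begin
    count P? (contents S′ R T′)
      ≡⟨ count-cast P? (ℕ.m+[n∸m]≡n a₁+a₂≤b) ((Ss ++ Rs) ++ Ts) ⟩
    count P? ((Ss ++ Rs) ++ Ts)
      ≡⟨ count-++ P? (Ss ++ Rs) Ts ⟩
    count P? (Ss ++ Rs) ℕ.+ count P? Ts
      ≡⟨ cong₂ ℕ._+_ (count-++ P? Ss Rs) (count-replicate-no P? ¬PT′ (b ℕ.∸ (a₁ ℕ.+ a₂))) ⟩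
    count P? Ss ℕ.+ count P? Rs ℕ.+ 0
      ≡⟨ ℕ.+-identityʳ _ ⟩
    count P? Ss ℕ.+ count P? Rs
      ≡⟨ cong₂ ℕ._+_ (count-replicate-yes P? PS′ a₁) (count-replicate-no P? ¬PR a₂) ⟩
    a₁ ℕ.+ 0
      ≡⟨ ℕ.+-identityʳ a₁ ⟩
    a₁ ∎
    where
    open ≡-Reasoning
    Ss = replicate a₁ S′
    Rs = replicate a₂ R
    Ts = replicate (b ℕ.∸ (a₁ ℕ.+ a₂)) T′

  uniformProb-contents : value (uniformProb {{b-nonZero}} P? (contents S′ R T′)) ≡ + a₁ / b
  uniformProb-contents = cong (λ c → + c / b) count-contents

-- A minimum is one of its two arguments. This makes `δ ⊓ ½` positive, so that a single `t` can be
-- chosen below both bounds.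
⊓-pres-m< : ∀ {p q r} → p < q → p < r → p < q ⊓ r
⊓-pres-m< {p} {q} {r} p<q p<r with ⊓-sel q r
... | inj₁ q⊓r≡q = subst (p <_) (sym q⊓r≡q) p<q
... | inj₂ q⊓r≡r = subst (p <_) (sym q⊓r≡r) p<r

discontinuousAt-one : (f : [0,1]ℚ → [0,1]ℚ) →
                      (∀ q → value q < 1ℚ → value (f q) ≡ value q) →
                      value (f one) ≡ 0ℚ →
                      DiscontinuousAt f one
discontinuousAt-one f f-below f-one continuous
  -- The jump at 1 has height 1, so an `ε` of one half is already too small for it.
  with continuous ½ (from-yes (0ℚ <? ½))
... | δ , 0<δ , close
  -- Each bound on `t` has its use: `0 < t` puts `1 - t` strictly below 1, where `f-below` applies;
  -- `t < δ` brings it close enough to 1; `t < ½` keeps it above `½`.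
  with <-dense (⊓-pres-m< 0<δ (from-yes (0ℚ <? ½)))
... | t , 0<t , t<δ⊓½ = <-asym ½<y y<½
  where
  y : ℚ
  y = 1ℚ - t

  ½<y : ½ < y
  -- The left-hand side produced here is `1ℚ - ½`, which computes to `½`.
  ½<y = +-monoʳ-< 1ℚ (neg-antimono-< (<-≤-trans t<δ⊓½ (p⊓q≤q δ ½)))

  y<1 : y < 1ℚ
  y<1 = +-monoʳ-< 1ℚ (neg-antimono-< 0<t)

  0≤y : 0ℚ ≤ y
  0≤y = <⇒≤ (<-trans (from-yes (0ℚ <? ½)) ½<y)

  q : [0,1]ℚ
  q = mk y 0≤y (<⇒≤ y<1)

  ∣y-1∣≡t : ∣ y - 1ℚ ∣ ≡ t
  ∣y-1∣≡t = begin
    -- Unfolded, `y - 1ℚ` is `- t` conjugated by `1ℚ`, and conjugation is trivial in an abelian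
    -- group.
    ∣ y - 1ℚ ∣  ≡⟨ cong ∣_∣ (xyx⁻¹≈y 1ℚ (- t)) ⟩
    ∣ - t ∣     ≡⟨ ∣-p∣≡∣p∣ t ⟩
    ∣ t ∣       ≡⟨ 0≤p⇒∣p∣≡p (<⇒≤ 0<t) ⟩
    t           ∎
    where open ≡-Reasoning

  ∣fq-f1∣≡y : ∣ value (f q) - value (f one) ∣ ≡ y
  ∣fq-f1∣≡y = begin
    ∣ value (f q) - value (f one) ∣  ≡⟨ cong₂ (λ u v → ∣ u - v ∣) (f-below q y<1) f-one ⟩
    ∣ y - 0ℚ ∣                       ≡⟨ cong ∣_∣ (+-identityʳ y) ⟩
    ∣ y ∣                            ≡⟨ 0≤p⇒∣p∣≡p 0≤y ⟩
    y                                ∎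
    where open ≡-Reasoning

  y<½ : y < ½
  -- Since `q` lies within `δ` of 1, continuity bounds the gap between the values of `f` by `½`, and
  -- that gap is `y` itself.
  y<½ = subst (_< ½) ∣fq-f1∣≡y
    (close q (subst (_< δ) (sym ∣y-1∣≡t) (<-≤-trans t<δ⊓½ (p⊓q≤p δ ½))))

mainTheorem2 : (V : Algorithm) → IsP₂ V →
    (n : ℕ) (d : Distribution V n) →
    (C : Pred (InputSet n) 0ℓ) → IsInputClass V d C →
    (i : Step V n) → IsMainStep V d i → lookup d i ≡ 2 →
    (L : Places V C i) →
    (S′ R T′ : InputSet n) → C S′ → C R → C T′ →
    SolutionAt V L S′ place-1 × ¬ SolutionAt V L S′ place-2 →
    ¬ SolutionAt V L R place-1 × SolutionAt V L R place-2 →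
    ¬ SolutionAt V L T′ place-1 × ¬ SolutionAt V L T′ place-2 →
    (F : BoxFamily) →
    let π₁ = π V L S′ R T′ F 1F in
    (∀ q → value q < 1ℚ → value (π₁ q) ≡ value q) ×
    (∀ q → value q ≡ 1ℚ → value (π₁ q) ≡ 0ℚ) ×
    DiscontinuousAt π₁ one
mainTheorem2 V _ n d C _ i _ _ L S′ R T′ _ _ _ (S₁ , ¬S₂) (¬R₁ , R₂) (¬T₁ , ¬T₂) F =
  -- The value of `one` is `1ℚ` by definition, hence `refl`.
  below , at-1 , discontinuousAt-one π₁ below (at-1 one refl)
  where
  open BoxFamily F
  π₁ = π V L S′ R T′ F 1F

  outcome-S′ : outcome V L S′ ≡ just 1F
  outcome-S′ = cong₂ outcomeOf (dec-true (solutionAt? V L S′ place-1) S₁)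
                               (dec-false (solutionAt? V L S′ place-2) ¬S₂)

  outcome-R : outcome V L R ≡ just 2F
  outcome-R = cong₂ outcomeOf (dec-false (solutionAt? V L R place-1) ¬R₁)
                              (dec-true (solutionAt? V L R place-2) R₂)

  outcome-T′ : outcome V L T′ ≡ just 0F
  outcome-T′ = cong₂ outcomeOf (dec-false (solutionAt? V L T′ place-1) ¬T₁)
                               (dec-false (solutionAt? V L T′ place-2) ¬T₂)

  -- The event of outcome 1 contains `S′` but neither `R` nor `T′`, whose outcomes 2 and 0 are
  -- distinct from 1. So this holds for every box, whichever condition `F` imposes on it.
  π₁≡a₁/b : ∀ q → let open Box (box q) in value (π₁ q) ≡ (+ a₁ / b) {{b-nonZero}}
  π₁≡a₁/b q = uniformProb-contents _ outcome-S′
    (λ eq → case trans (sym outcome-R) eq of λ ())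
    (λ eq → case trans (sym outcome-T′) eq of λ ())
    (box q)

  below : ∀ q → value q < 1ℚ → value (π₁ q) ≡ value q
  below q q<1 = trans (π₁≡a₁/b q) (proj₂ (below-one q q<1))

  at-1 : ∀ q → value q ≡ 1ℚ → value (π₁ q) ≡ 0ℚ
  at-1 q q≡1 = begin
    value (π₁ q)               ≡⟨ π₁≡a₁/b q ⟩
    -- At 1 the family switches from `S′` to `R`, so the numerator drops to 0.
    (+ a₁ / b) {{b-nonZero}}   ≡⟨ cong (λ c → (+ c / b) {{b-nonZero}}) (proj₁ (at-one q q≡1)) ⟩
    (+ 0 / b) {{b-nonZero}}    ≡⟨ 0/n≡0 b {{b-nonZero}} ⟩
    0ℚ                         ∎
    where
    open Box (box q)
    open ≡-Reasoning
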